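{- Let $m=2^\ell\ge 4$ and let $R\subseteq\{0,1\}^N\times W$ be a relation. Then $C^{dt}(R)=O\big(\log_m L^{\oplus,\oplus}(R\circ\mathrm{IND}_m^N)\big)$.
   Context: $\mathrm{IND}_m:[m]\times\{0,1\}^m\to\{0,1\}$, $\mathrm{IND}_m(x,y)=y_x$. Alice's input $x\in[m]^N$ is encoded by Boolean variables $x_{i,j'}$ ($i\in[N]$, $0\le j'<\ell$), the binary representation of $x_i$; Bob's input is $y\in(\{0,1\}^m)^N$ with Boolean variables $y_{i,j}$. $R\circ\mathrm{IND}_m^N$ relates $(x,y)$ to $w$ iff $(\mathrm{IND}_m^N(x,y),w)\in R$, where $\mathrm{IND}_m^N(x,y)=(\mathrm{IND}_m(x_i,y_i))_i$. A parity-communication protocol is a deterministic two-party protocol in which every bit sent by Alice is a parity (over $\mathbb{F}_2$) of her input bits and every bit sent by Bob is a parity of his input bits, chosen depending on the transcript so far; it solves the relation if on each input it outputs a related $w$ (or $\bot$ if none exists). $L^{\oplus,\oplus}(R')$ is the minimum number of leaves of a parity-communication protocol solving $R'$. $C^{dt}(R)$ is the minimum height of a decision tree on $z\in\{0,1\}^N$ outputting some $w$ with $(z,w)\in R$ (or $\bot$ if none exists). -}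

module Defs where

open import Data.Bool.Base using (Bool; false; _∧_; _xor_; if_then_else_)
open import Data.Fin.Base using (Fin; finToFun)
open import Data.Fin.Properties using (2↔Bool)
open import Data.Fin.Subset using (Subset)
open import Data.Maybe.Base using (Maybe; just; nothing)
open import Data.Nat.Base using (ℕ; suc; _+_; _*_; _^_; _≤_; _⊔_)
open import Data.Product.Base using (Σ; _×_; _,_)
open import Data.Vec.Base using (Vec; concat; foldr′; lookup; map; tabulate; zipWith)
open import Function.Base using (_∘_)
open import Function.Bundles using (Inverse)
open import Level using (Level)
import Level
open import Relation.Binary.Core using (REL)
open import Relation.Binary.PropositionalEquality.Core using (_≡_)
open import Relation.Nullary.Negation.Core using (¬_)

private
  variable
    a r p : Level
    ℓ m n k N : ℕ

IsMinimum : (ℕ → Set p) → ℕ → Set p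
IsMinimum P n = P n × (∀ k → P k → n ≤ k)

-- An output is an element of Maybe W, where nothing plays the role of ⊥.
data Correct {A : Set p} {W : Set a} (R : REL A W r) (v : A) : Maybe W → Set (a Level.⊔ r) where
  related : ∀ {w} → R v w → Correct R v (just w)
  none    : (∀ w → ¬ R v w) → Correct R v nothing

data DecisionTree (N : ℕ) (O : Set a) : Set a where
  leaf  : O → DecisionTree N O
  query : Fin N → (if-false if-true : DecisionTree N O) → DecisionTree N O

height : {O : Set a} → DecisionTree N O → ℕ
height (leaf _)      = 0
height (query _ s t) = suc (height s ⊔ height t)

evaluate : {O : Set a} → DecisionTree N O → Vec Bool N → O
evaluate (leaf o)      z = o
evaluate (query i s t) z = if lookup z i then evaluate t z else evaluate s z

SolvedByTree : {W : Set a} → REL (Vec Bool N) W r → DecisionTree N (Maybe W) → Set (a Level.⊔ r)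
SolvedByTree R T = ∀ z → Correct R z (evaluate T z)

IsCdt : {W : Set a} → REL (Vec Bool N) W r → ℕ → Set (a Level.⊔ r)
IsCdt {N = N} {W = W} R =
  IsMinimum λ d → Σ (DecisionTree N (Maybe W)) λ T → SolvedByTree R T × height T ≡ d

parity : Subset n → Vec Bool n → Bool
parity S v = foldr′ _xor_ false (zipWith _∧_ S v)

-- Alice holds n input bits and Bob holds k; the node (who speaks and which
-- parity is sent) is determined by the transcript, i.e. the path from the root.
data ParityProtocol (n k : ℕ) (O : Set a) : Set a where
  leaf  : O → ParityProtocol n k O
  alice : Subset n → (if-false if-true : ParityProtocol n k O) → ParityProtocol n k O
  bob   : Subset k → (if-false if-true : ParityProtocol n k O) → ParityProtocol n k O

leaves : {O : Set a} → ParityProtocol n k O → ℕ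
leaves (leaf _)      = 1
leaves (alice _ s t) = leaves s + leaves t
leaves (bob _ s t)   = leaves s + leaves t

run : {O : Set a} → ParityProtocol n k O → Vec Bool n → Vec Bool k → O
run (leaf o)      u v = o
run (alice S s t) u v = if parity S u then run t u v else run s u v
run (bob S s t)   u v = if parity S v then run t u v else run s u v

AliceInput : ℕ → ℕ → Set
AliceInput ℓ N = Vec (Fin (2 ^ ℓ)) N

BobInput : ℕ → ℕ → Set
BobInput ℓ N = Vec (Vec Bool (2 ^ ℓ)) N

-- Most significant bit first.
binary : Fin (2 ^ ℓ) → Vec Bool ℓ
binary x = tabulate (Inverse.to 2↔Bool ∘ finToFun x)

aliceBits : AliceInput ℓ N → Vec Bool (N * ℓ)
aliceBits {ℓ} x = concat (map (binary {ℓ}) x)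

bobBits : BobInput ℓ N → Vec Bool (N * 2 ^ ℓ)
bobBits = concat

SolvedByProtocol : {W : Set a} → REL (AliceInput ℓ N × BobInput ℓ N) W r →
                   ParityProtocol (N * ℓ) (N * 2 ^ ℓ) (Maybe W) → Set (a Level.⊔ r)
SolvedByProtocol {ℓ = ℓ} {N = N} R′ Π =
  ∀ x y → Correct R′ (x , y) (run Π (aliceBits {ℓ} x) (bobBits {ℓ} y))

IsL⊕⊕ : {W : Set a} → REL (AliceInput ℓ N × BobInput ℓ N) W r → ℕ → Set (a Level.⊔ r)
IsL⊕⊕ {ℓ = ℓ} {N = N} {W = W} R′ =
  IsMinimum λ L → Σ (ParityProtocol (N * ℓ) (N * 2 ^ ℓ) (Maybe W)) λ Π →
    SolvedByProtocol {ℓ = ℓ} R′ Π × leaves Π ≡ L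

IND : Fin m → Vec Bool m → Bool
IND x y = lookup y x

IND^ : Vec (Fin m) N → Vec (Vec Bool m) N → Vec Bool N
IND^ = zipWith IND

_∘IND[_] : {W : Set a} → REL (Vec Bool N) W r → (m : ℕ) →
           REL (Vec (Fin m) N × Vec (Vec Bool m) N) W r
(R ∘IND[ m ]) (x , y) w = R (IND^ x y) w

{-# OPTIONS --safe #-}

-- Walk down the protocol, keeping the inputs of each player that are consistent
-- with the transcript in parametrized form: some variables are bound, being
-- affine functions of the others, which are free.  A parity that is not yet
-- constant is answered so as to enter the subtree with fewer leaves, and binds one
-- more variable.  If block i has α bound variables of Alice and β of Bob, and
-- β < 2^(ℓ ∸ α), then by counting Alice can set her free bits in the block so that
-- her pointer misses all of Bob's bound variables, whatever her bound bits become;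
-- the gadget can then still take either value.  When a new bound variable would
-- break this inequality, one has α + β ≥ ℓ; the tree first queries zᵢ, Alice sets
-- her free bits in that way and Bob sets all his free bits in the block to zᵢ.
-- Each query is thus paid for by ℓ halvings of the number of leaves, which gives
-- m ^ height ≤ L.
module Submission where

open import Defs
open import Algebra.Bundles using (CommutativeRing)
import Algebra.Properties.CommutativeSemigroup as CommutativeSemigroupProperties
open import Algebra.Properties.Monoid.Sum using (sum-replicate-zero)
open import Data.Bool.Base using (Bool; true; false; not; _∧_; _xor_; if_then_else_)
open import Data.Bool.Properties using (xor-same; xor-assoc; xor-identityʳ; ∧-distribˡ-xor; ∧-distribʳ-xor; ∧-zeroʳ; ∧-identityʳ; ¬-not; xor-∧-commutativeRing)
import Data.Bool.Properties as Bool
open import Data.Fin.Base using (Fin; zero; suc; combine; remQuot; funToFin)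
open import Data.Fin.Properties using (_≟_; any?; 2↔Bool; remQuot-combine; combine-injective; combine-surjective; finToFun-funToFin)
open import Data.Fin.Subset using (Subset; ∣_∣; ∁; ⊤; ⊥)
open import Data.Fin.Subset.Properties using (∣⊥∣≡0; ∣∁p∣≡n∸∣p∣; ∣p∣≤n)
open import Data.List.Base as List using (List; []; _∷_; length)
open import Data.List.Membership.Propositional using (_∈_; _∉_)
open import Data.List.Membership.Propositional.Properties using (∈-map⁺)
open import Data.List.Properties using (length-map)
open import Data.List.Relation.Unary.Any using (here; there)
open import Data.Maybe.Base using (Maybe; just; nothing)
open import Data.Nat.Base using (ℕ; zero; suc; _+_; _*_; _^_; _≤_; _<_; _⊔_; z≤n; s≤s)
open import Data.Nat.Induction using (<-wellFounded)
open import Data.Nat.Properties hiding (_≟_)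
open import Data.Nat.Tactic.RingSolver using (solve-∀)
open import Data.Product.Base using (Σ; ∃; ∃₂; _×_; _,_; proj₁; proj₂; uncurry)
open import Data.Sum.Base using (_⊎_; inj₁; inj₂)
open import Data.Vec.Base as Vec using (Vec; []; _∷_; lookup; tabulate; zipWith; replicate; concat; _[_]≔_)
open import Data.Vec.Functional using (Vector; updateAt)
open import Data.Vec.Functional.Properties using (updateAt-updates; updateAt-minimal)
open import Data.Vec.Properties using (lookup∘updateAt; lookup∘updateAt′; lookup∘update; lookup∘update′; lookup-zipWith; lookup-replicate; lookup-map; lookup-concat; lookup∘tabulate; tabulate∘lookup; tabulate-cong; zipWith-identityʳ)
open import Function.Base using (_∘_; const; id; case_of_)
open import Function.Bundles using (Inverse)
open import Induction.WellFounded using (Acc; acc)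
open import Level using (Level)
import Level
open import Relation.Binary.Core using (REL)
open import Relation.Binary.PropositionalEquality
open import Relation.Nullary using (Dec; yes; no; does; ¬_; contradiction; _×-dec_)

open Algebra.Properties.Monoid.Sum +-0-monoid using (sum; sum-cong-≗)

private
  variable
    a r : Level
    n k ℓ N : ℕ

-- Vectors over 𝔽₂

infixl 6 _⊕_

_⊕_ : Vec Bool n → Vec Bool n → Vec Bool n
_⊕_ = zipWith _xor_

𝟎 : Vec Bool n
𝟎 = replicate _ false

scale : Bool → Vec Bool n → Vec Bool n
scale c = Vec.map (c ∧_)

flip : Fin n → Vec Bool n → Vec Bool n
flip p v = Vec.updateAt v p not

open CommutativeSemigroupProperties
  (CommutativeRing.+-commutativeSemigroup xor-∧-commutativeRing)
  using () renaming (interchange to xor-interchange; xy∙z≈xz∙y to xor-swap)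

⊕-identityʳ : (v : Vec Bool n) → v ⊕ 𝟎 ≡ v
⊕-identityʳ = zipWith-identityʳ xor-identityʳ

⊕-self : (v : Vec Bool n) → v ⊕ v ≡ 𝟎
⊕-self []      = refl
⊕-self (x ∷ v) = cong₂ _∷_ (xor-same x) (⊕-self v)

⊕-interchange : (u v w x : Vec Bool n) → (u ⊕ v) ⊕ (w ⊕ x) ≡ (u ⊕ w) ⊕ (v ⊕ x)
⊕-interchange []      []      []      []      = refl
⊕-interchange (b ∷ u) (c ∷ v) (d ∷ w) (e ∷ x) =
  cong₂ _∷_ (xor-interchange b c d e) (⊕-interchange u v w x)

scale-false : (v : Vec Bool n) → scale false v ≡ 𝟎
scale-false []      = refl
scale-false (_ ∷ v) = cong (false ∷_) (scale-false v)

scale-true : (v : Vec Bool n) → scale true v ≡ v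
scale-true []      = refl
scale-true (x ∷ v) = cong (x ∷_) (scale-true v)

scale-xor : (c d : Bool) (v : Vec Bool n) → scale (c xor d) v ≡ scale c v ⊕ scale d v
scale-xor c d []      = refl
scale-xor c d (x ∷ v) = cong₂ _∷_ (∧-distribʳ-xor x c d) (scale-xor c d v)

parity-⊕ : (S : Subset n) (u v : Vec Bool n) → parity S (u ⊕ v) ≡ parity S u xor parity S v
parity-⊕ []      []      []      = refl
parity-⊕ (s ∷ S) (x ∷ u) (y ∷ v) = begin
  (s ∧ (x xor y)) xor parity S (u ⊕ v)
    ≡⟨ cong₂ _xor_ (∧-distribˡ-xor s x y) (parity-⊕ S u v) ⟩
  ((s ∧ x) xor (s ∧ y)) xor (parity S u xor parity S v)
    ≡⟨ xor-interchange (s ∧ x) (s ∧ y) (parity S u) (parity S v) ⟩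
  ((s ∧ x) xor parity S u) xor ((s ∧ y) xor parity S v) ∎
  where open ≡-Reasoning

parity-𝟎 : (S : Subset n) → parity S 𝟎 ≡ false
parity-𝟎 []      = refl
parity-𝟎 (s ∷ S) = cong₂ _xor_ (∧-zeroʳ s) (parity-𝟎 S)

parity-scale : (S : Subset n) (c : Bool) (v : Vec Bool n) → parity S (scale c v) ≡ c ∧ parity S v
parity-scale S false v = trans (cong (parity S) (scale-false v)) (parity-𝟎 S)
parity-scale S true  v = cong (parity S) (scale-true v)

-- Any two vectors are joined by a chain of single-coordinate flips. It turns vanishing directional
-- derivatives into constancy of a parity.
flip-invariant⇒constant : (f : Vec Bool n → Bool) → (∀ p v → f (flip p v) ≡ f v) → ∀ v w → f v ≡ f w
flip-invariant⇒constant f inv []      []      = refl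
flip-invariant⇒constant f inv (x ∷ v) (y ∷ w) =
  trans (flip-invariant⇒constant (f ∘ (x ∷_)) (λ p u → inv (suc p) (x ∷ u)) v w) (head-irrelevant x y)
  where
  head-irrelevant : ∀ x y → f (x ∷ w) ≡ f (y ∷ w)
  head-irrelevant false false = refl
  head-irrelevant false true  = sym (inv zero (false ∷ w))
  head-irrelevant true  false = sym (inv zero (true ∷ w))
  head-irrelevant true  true  = refl

lookup-ext : {A : Set a} {u v : Vec A n} → (∀ p → lookup u p ≡ lookup v p) → u ≡ v
lookup-ext {u = u} {v} eq = trans (sym (tabulate∘lookup u)) (trans (tabulate-cong eq) (tabulate∘lookup v))

-- Vectors divided into N blocks of length k

blockwise : {A : Set a} → (Fin N → Fin k → A) → Vec A (N * k)
blockwise {k = k} f = tabulate (uncurry f ∘ remQuot k)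

lookup-blockwise : {A : Set a} (f : Fin N → Fin k → A) (i : Fin N) (j : Fin k) →
                   lookup (blockwise f) (combine i j) ≡ f i j
lookup-blockwise f i j =
  trans (lookup∘tabulate _ (combine i j)) (cong (uncurry f) (remQuot-combine i j))

block-ext : {A : Set a} {u v : Vec A (N * k)} →
            (∀ (i : Fin N) (j : Fin k) → lookup u (combine i j) ≡ lookup v (combine i j)) → u ≡ v
block-ext {N = N} {k} {u = u} {v} eq = lookup-ext λ p →
  case combine-surjective {N} {k} p of λ where
    (i , j , refl) → eq i j

block : {A : Set a} → Fin N → Vec A (N * k) → Vec A k
block i v = tabulate (λ j → lookup v (combine i j))

overwrite : Fin N → Vec Bool k → Vec Bool (N * k) → Vec Bool (N * k)
overwrite i u v = blockwise λ i′ j → if does (i′ ≟ i) then lookup u j else lookup v (combine i′ j)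

lookup-overwrite : (i : Fin N) (u : Vec Bool k) (v : Vec Bool (N * k)) (j : Fin k) →
                   lookup (overwrite i u v) (combine i j) ≡ lookup u j
lookup-overwrite {N = N} i u v j with eq ← lookup-blockwise (λ i′ j → if does (i′ ≟ i) then lookup u j else lookup v (combine i′ j)) i j | i ≟ i
... | yes _  = eq
... | no i≢i = contradiction refl i≢i

lookup-overwrite′ : (i : Fin N) (u : Vec Bool k) (v : Vec Bool (N * k)) {i′ : Fin N} → i′ ≢ i → (j : Fin k) →
                    lookup (overwrite i u v) (combine i′ j) ≡ lookup v (combine i′ j)
lookup-overwrite′ i u v {i′} i′≢i j with eq ← lookup-blockwise (λ i′ j → if does (i′ ≟ i) then lookup u j else lookup v (combine i′ j)) i′ j | i′ ≟ i
... | yes i′≡i = contradiction i′≡i i′≢i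
... | no _     = eq

lookup-flip′ : (v : Vec Bool (N * k)) (i i′ : Fin N) (j j′ : Fin k) → ¬ (i′ ≡ i × j′ ≡ j) →
               lookup (flip (combine i j) v) (combine i′ j′) ≡ lookup v (combine i′ j′)
lookup-flip′ v i i′ j j′ ne = lookup∘updateAt′ _ _ (ne ∘ combine-injective i′ j′ i j) v

overwrite-flip : (i : Fin N) (u : Vec Bool k) (v : Vec Bool (N * k)) (j : Fin k) →
                 overwrite i u (flip (combine i j) v) ≡ overwrite i u v
overwrite-flip i u v j = block-ext agree
  where
  v′ = flip (combine i j) v

  agree : ∀ i′ j′ → lookup (overwrite i u v′) (combine i′ j′) ≡ lookup (overwrite i u v) (combine i′ j′)
  agree i′ j′ with i′ ≟ i
  ... | yes refl = trans (lookup-overwrite i u v′ j′) (sym (lookup-overwrite i u v j′))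
  ... | no i′≢i  = trans (lookup-overwrite′ i u v′ i′≢i j′)
                     (trans (lookup-flip′ v i i′ j j′ (i′≢i ∘ proj₁)) (sym (lookup-overwrite′ i u v i′≢i j′)))

overwrite-flip′ : (i : Fin N) (u : Vec Bool k) (v : Vec Bool (N * k)) {i₁ : Fin N} → i₁ ≢ i → (j : Fin k) →
                  overwrite i u (flip (combine i₁ j) v) ≡ flip (combine i₁ j) (overwrite i u v)
overwrite-flip′ i u v {i₁} i₁≢i j = block-ext agree
  where
  open ≡-Reasoning
  p  = combine i₁ j
  v′ = flip p v
  o  = overwrite i u v

  agree : ∀ i′ j′ → lookup (overwrite i u v′) (combine i′ j′) ≡ lookup (flip p o) (combine i′ j′)
  agree i′ j′ with i′ ≟ i | i′ ≟ i₁ ×-dec j′ ≟ j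
  ... | yes refl | _ = begin
    lookup (overwrite i u v′) (combine i j′)  ≡⟨ lookup-overwrite i u v′ j′ ⟩
    lookup u j′                               ≡⟨ lookup-overwrite i u v j′ ⟨
    lookup o (combine i j′)                   ≡⟨ lookup-flip′ o i₁ i j j′ (i₁≢i ∘ sym ∘ proj₁) ⟨
    lookup (flip p o) (combine i j′)          ∎
  ... | no _ | yes (refl , refl) = begin
    lookup (overwrite i u v′) p  ≡⟨ lookup-overwrite′ i u v′ i₁≢i j ⟩
    lookup v′ p                  ≡⟨ lookup∘updateAt p v ⟩
    not (lookup v p)             ≡⟨ cong not (lookup-overwrite′ i u v i₁≢i j) ⟨
    not (lookup o p)             ≡⟨ lookup∘updateAt p o ⟨
    lookup (flip p o) p          ∎
  ... | no i′≢i | no ne = begin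
    lookup (overwrite i u v′) (combine i′ j′)  ≡⟨ lookup-overwrite′ i u v′ i′≢i j′ ⟩
    lookup v′ (combine i′ j′)                  ≡⟨ lookup-flip′ v i₁ i′ j j′ ne ⟩
    lookup v (combine i′ j′)                   ≡⟨ lookup-overwrite′ i u v i′≢i j′ ⟨
    lookup o (combine i′ j′)                   ≡⟨ lookup-flip′ o i₁ i′ j j′ ne ⟨
    lookup (flip p o) (combine i′ j′)          ∎

-- Affine parametrizations

-- An affine map 𝔽₂^(N k) → 𝔽₂^(N k), presented by its directional derivatives,
-- whose image is the solution set of a linear system in reduced form: the free
-- variables are the parameters, and the bound ones are functions of them.
record Parametrization (N k : ℕ) : Set where
  field
    point       : Vec Bool (N * k) → Vec Bool (N * k)
    slope       : Fin N → Fin k → Vec Bool (N * k)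
    bound       : Vector (Subset k) N
    point-flip  : ∀ i j v → point (flip (combine i j) v) ≡ point v ⊕ slope i j
    bound-slope : ∀ i j → lookup (bound i) j ≡ true → slope i j ≡ 𝟎
    free-point  : ∀ i j → lookup (bound i) j ≡ false → ∀ v → lookup (point v) (combine i j) ≡ lookup v (combine i j)

open Parametrization

flip-⊕ : (p : Fin n) (v : Vec Bool n) → flip p v ≡ v ⊕ flip p 𝟎
flip-⊕ zero    (x ∷ v) = cong₂ _∷_ (sym (trans (Bool.xor-comm x true) (Bool.true-xor x))) (sym (⊕-identityʳ v))
flip-⊕ (suc p) (x ∷ v) = cong₂ _∷_ (sym (xor-identityʳ x)) (flip-⊕ p v)

unrestricted : Parametrization N k
unrestricted .point           = id
unrestricted .slope i j       = flip (combine i j) 𝟎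
unrestricted .bound _         = ⊥
unrestricted .point-flip i j  = flip-⊕ (combine i j)
unrestricted .bound-slope i j eq with () ← trans (sym eq) (lookup-replicate j false)
unrestricted .free-point _ _ _ _ = refl

-- Overwriting the parameters of block `i` kills their slopes, so the whole block counts as bound.
-- Coordinates of the block that were bound before need not become constants: they may still depend
-- on parameters of other blocks.
fixBlock : (i : Fin N) (u : Vec Bool k) → Parametrization N k → Parametrization N k
fixBlock {N} {k} i u A = record
  { point       = point A ∘ overwrite i u
  ; slope       = slope′
  ; bound       = bound′
  ; point-flip  = point-flip′
  ; bound-slope = bound-slope′
  ; free-point  = free-point′
  }
  where
  bound′ = updateAt (bound A) i (const ⊤)

  slope′ : Fin N → Fin k → Vec Bool (N * k)
  slope′ i′ j with i′ ≟ i
  ... | yes _ = 𝟎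
  ... | no _  = slope A i′ j

  point-flip′ : ∀ i′ j v → point A (overwrite i u (flip (combine i′ j) v)) ≡ point A (overwrite i u v) ⊕ slope′ i′ j
  point-flip′ i′ j v with i′ ≟ i
  ... | yes refl = trans (cong (point A) (overwrite-flip i u v j)) (sym (⊕-identityʳ _))
  ... | no i′≢i  = trans (cong (point A) (overwrite-flip′ i u v i′≢i j)) (point-flip A i′ j _)

  bound-slope′ : ∀ i′ j → lookup (bound′ i′) j ≡ true → slope′ i′ j ≡ 𝟎
  bound-slope′ i′ j eq with i′ ≟ i
  ... | yes _   = refl
  ... | no i′≢i = bound-slope A i′ j (subst (λ s → lookup s j ≡ true) (updateAt-minimal i′ i (bound A) i′≢i) eq)

  free-point′ : ∀ i′ j → lookup (bound′ i′) j ≡ false → ∀ v →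
                lookup (point A (overwrite i u v)) (combine i′ j) ≡ lookup v (combine i′ j)
  free-point′ i′ j eq v with i′ ≟ i
  ... | yes refl with () ← trans (sym (subst (λ s → lookup s j ≡ false) (updateAt-updates i (bound A)) eq)) (lookup-replicate j true)
  ... | no i′≢i  = trans
    (free-point A i′ j (subst (λ s → lookup s j ≡ false) (updateAt-minimal i′ i (bound A) i′≢i) eq) _)
    (lookup-overwrite′ i u v i′≢i j)

-- Imposing parity S = b by solving for the variable (i , j).
module Restrict (A : Parametrization N k) (S : Subset (N * k)) (i : Fin N) (j : Fin k)
                (pivot : parity S (slope A i j) ≡ true) (b : Bool) where

  private
    p = combine i j
    s = slope A i j

  -- Flipping the pivot parameter adds `s`, which has odd parity, so one flip repairs a wrong value
  -- and every parameter vector is sent to a solution.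
  adjust : Vec Bool (N * k) → Vec Bool (N * k)
  adjust v = if parity S (point A v) xor b then flip p v else v

  point-adjust : ∀ v → point A (adjust v) ≡ point A v ⊕ scale (parity S (point A v) xor b) s
  point-adjust v with parity S (point A v) xor b
  ... | true  = trans (point-flip A i j v) (cong (point A v ⊕_) (sym (scale-true s)))
  ... | false = trans (sym (⊕-identityʳ _)) (cong (point A v ⊕_) (sym (scale-false s)))

  parity-adjust : ∀ v → parity S (point A (adjust v)) ≡ b
  parity-adjust v = begin
    parity S (point A (adjust v))            ≡⟨ cong (parity S) (point-adjust v) ⟩
    parity S (point A v ⊕ scale (t xor b) s) ≡⟨ parity-⊕ S (point A v) _ ⟩
    t xor parity S (scale (t xor b) s)       ≡⟨ cong (t xor_) (parity-scale S (t xor b) s) ⟩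
    t xor ((t xor b) ∧ parity S s)           ≡⟨ cong (λ c → t xor ((t xor b) ∧ c)) pivot ⟩
    t xor ((t xor b) ∧ true)                 ≡⟨ cong (t xor_) (∧-identityʳ (t xor b)) ⟩
    t xor (t xor b)                          ≡⟨ xor-assoc t t b ⟨
    (t xor t) xor b                          ≡⟨ cong (_xor b) (xor-same t) ⟩
    b                                        ∎
    where
    open ≡-Reasoning
    t = parity S (point A v)

  -- The column operation of Gaussian elimination: a column of odd parity receives the pivot column,
  -- after which every column has even parity.
  slope′ : Fin N → Fin k → Vec Bool (N * k)
  slope′ i′ j′ = slope A i′ j′ ⊕ scale (parity S (slope A i′ j′)) s

  bound′ : Vector (Subset k) N
  bound′ = updateAt (bound A) i (_[ j ]≔ true)

  point-flip′ : ∀ i′ j′ v → point A (adjust (flip (combine i′ j′) v)) ≡ point A (adjust v) ⊕ slope′ i′ j′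
  point-flip′ i′ j′ v = begin
    point A (adjust v′)
      ≡⟨ point-adjust v′ ⟩
    point A v′ ⊕ scale (parity S (point A v′) xor b) s
      ≡⟨ cong (λ x → x ⊕ scale (parity S x xor b) s) (point-flip A i′ j′ v) ⟩
    (x ⊕ s′) ⊕ scale (parity S (x ⊕ s′) xor b) s
      ≡⟨ cong (λ c → (x ⊕ s′) ⊕ scale (c xor b) s) (parity-⊕ S x s′) ⟩
    (x ⊕ s′) ⊕ scale ((t xor t′) xor b) s
      ≡⟨ cong (λ c → (x ⊕ s′) ⊕ scale c s) (xor-swap t t′ b) ⟩
    (x ⊕ s′) ⊕ scale ((t xor b) xor t′) s
      ≡⟨ cong ((x ⊕ s′) ⊕_) (scale-xor (t xor b) t′ s) ⟩
    (x ⊕ s′) ⊕ (scale (t xor b) s ⊕ scale t′ s)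
      ≡⟨ ⊕-interchange x s′ _ _ ⟩
    (x ⊕ scale (t xor b) s) ⊕ (s′ ⊕ scale t′ s)
      ≡⟨ cong (_⊕ slope′ i′ j′) (point-adjust v) ⟨
    point A (adjust v) ⊕ slope′ i′ j′ ∎
    where
    open ≡-Reasoning
    v′ = flip (combine i′ j′) v
    x  = point A v
    s′ = slope A i′ j′
    t  = parity S x
    t′ = parity S s′

  slope′-pivot : slope′ i j ≡ 𝟎
  slope′-pivot = begin
    s ⊕ scale (parity S s) s  ≡⟨ cong (λ c → s ⊕ scale c s) pivot ⟩
    s ⊕ scale true s          ≡⟨ cong (s ⊕_) (scale-true s) ⟩
    s ⊕ s                     ≡⟨ ⊕-self s ⟩
    𝟎                         ∎
    where open ≡-Reasoning

  slope′-bound : ∀ i′ j′ → slope A i′ j′ ≡ 𝟎 → slope′ i′ j′ ≡ 𝟎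
  slope′-bound i′ j′ eq = begin
    slope′ i′ j′               ≡⟨ cong (λ x → x ⊕ scale (parity S x) s) eq ⟩
    𝟎 ⊕ scale (parity S 𝟎) s   ≡⟨ cong (λ c → 𝟎 ⊕ scale c s) (parity-𝟎 S) ⟩
    𝟎 ⊕ scale false s          ≡⟨ cong (𝟎 ⊕_) (scale-false s) ⟩
    𝟎 ⊕ 𝟎                      ≡⟨ ⊕-self 𝟎 ⟩
    𝟎                          ∎
    where open ≡-Reasoning

  bound′-pivot : lookup (bound′ i) j ≡ true
  bound′-pivot = trans (cong (λ t → lookup t j) (updateAt-updates i (bound A))) (lookup∘update j (bound A i) true)

  bound′-other : ∀ i′ j′ → ¬ (i′ ≡ i × j′ ≡ j) → lookup (bound′ i′) j′ ≡ lookup (bound A i′) j′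
  bound′-other i′ j′ ne with i′ ≟ i
  ... | yes refl = trans (cong (λ t → lookup t j′) (updateAt-updates i (bound A)))
                     (lookup∘update′ (λ j′≡j → ne (refl , j′≡j)) (bound A i) true)
  ... | no i′≢i  = cong (λ t → lookup t j′) (updateAt-minimal i′ i (bound A) i′≢i)

  bound-slope′ : ∀ i′ j′ → lookup (bound′ i′) j′ ≡ true → slope′ i′ j′ ≡ 𝟎
  bound-slope′ i′ j′ eq with i′ ≟ i ×-dec j′ ≟ j
  ... | yes (refl , refl) = slope′-pivot
  ... | no ne = slope′-bound i′ j′ (bound-slope A i′ j′ (trans (sym (bound′-other i′ j′ ne)) eq))

  lookup-adjust : ∀ i′ j′ → ¬ (i′ ≡ i × j′ ≡ j) → ∀ v → lookup (adjust v) (combine i′ j′) ≡ lookup v (combine i′ j′)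
  lookup-adjust i′ j′ ne v with parity S (point A v) xor b
  ... | true  = lookup-flip′ v i i′ j j′ ne
  ... | false = refl

  free-point′ : ∀ i′ j′ → lookup (bound′ i′) j′ ≡ false → ∀ v →
                lookup (point A (adjust v)) (combine i′ j′) ≡ lookup v (combine i′ j′)
  free-point′ i′ j′ eq v with i′ ≟ i ×-dec j′ ≟ j
  ... | yes (refl , refl) with () ← trans (sym eq) bound′-pivot
  ... | no ne = trans (free-point A i′ j′ (trans (sym (bound′-other i′ j′ ne)) eq) (adjust v))
                  (lookup-adjust i′ j′ ne v)

  restricted : Parametrization N k
  restricted = record
    { point       = point A ∘ adjust
    ; slope       = slope′
    ; bound       = bound′
    ; point-flip  = point-flip′
    ; bound-slope = bound-slope′
    ; free-point  = free-point′
    }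

  -- A bound parameter has zero slope and hence even parity. A pivot is therefore always new, and
  -- each restriction raises the bound count by exactly one.
  pivot-free : lookup (bound A i) j ≡ false
  pivot-free = ¬-not λ eq → case trans (sym pivot) (trans (cong (parity S) (bound-slope A i j eq)) (parity-𝟎 S)) of λ ()

open Restrict using (restricted; parity-adjust; pivot-free)

Constant : Parametrization N k → Subset (N * k) → Set
Constant A S = ∃ λ b → ∀ v → parity S (point A v) ≡ b

Pivot : Parametrization N k → Subset (N * k) → Set
Pivot A S = ∃₂ λ i j → parity S (slope A i j) ≡ true

-- Along the parametrization the parity is an affine function whose coefficients are the parities of
-- the slopes: either one coefficient is nonzero or no flip changes the value.
constant⊎pivot : (A : Parametrization N k) (S : Subset (N * k)) → Constant A S ⊎ Pivot A S
constant⊎pivot {N} {k} A S with any? (λ i → any? (λ j → parity S (slope A i j) Bool.≟ true))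
... | yes pivot = inj₂ pivot
... | no ∄pivot = inj₁ (parity S (point A 𝟎) , λ v → flip-invariant⇒constant (parity S ∘ point A) invariant v 𝟎)
  where
  invariant : ∀ p v → parity S (point A (flip p v)) ≡ parity S (point A v)
  invariant p v with i , j , refl ← combine-surjective {N} {k} p = begin
    parity S (point A (flip (combine i j) v))             ≡⟨ cong (parity S) (point-flip A i j v) ⟩
    parity S (point A v ⊕ slope A i j)                    ≡⟨ parity-⊕ S (point A v) (slope A i j) ⟩
    parity S (point A v) xor parity S (slope A i j)       ≡⟨ cong (parity S (point A v) xor_) (¬-not λ eq → ∄pivot (i , j , eq)) ⟩
    parity S (point A v) xor false                        ≡⟨ xor-identityʳ _ ⟩
    parity S (point A v)                                  ∎
    where open ≡-Reasoning

-- Counting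

∣insert∣ : (s : Subset n) (j : Fin n) → lookup s j ≡ false → ∣ s [ j ]≔ true ∣ ≡ suc ∣ s ∣
∣insert∣ (false ∷ s) zero    _  = refl
∣insert∣ (false ∷ s) (suc j) eq = ∣insert∣ s j eq
∣insert∣ (true  ∷ s) (suc j) eq = cong suc (∣insert∣ s j eq)

∣∁insert∣ : (s : Subset n) (j : Fin n) → lookup s j ≡ false → ∣ ∁ s ∣ ≡ suc ∣ ∁ (s [ j ]≔ true) ∣
∣∁insert∣ (false ∷ s) zero    _  = refl
∣∁insert∣ (false ∷ s) (suc j) eq = cong suc (∣∁insert∣ s j eq)
∣∁insert∣ (true  ∷ s) (suc j) eq = ∣∁insert∣ s j eq

∣p∣+∣∁p∣≡n : (s : Subset n) → ∣ s ∣ + ∣ ∁ s ∣ ≡ n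
∣p∣+∣∁p∣≡n s = trans (cong (∣ s ∣ +_) (∣∁p∣≡n∸∣p∣ s)) (m+[n∸m]≡n (∣p∣≤n s))

members : Subset n → List (Fin n)
members []          = []
members (true  ∷ s) = zero ∷ List.map suc (members s)
members (false ∷ s) = List.map suc (members s)

length-members : (s : Subset n) → length (members s) ≡ ∣ s ∣
length-members []          = refl
length-members (true  ∷ s) = cong suc (trans (length-map suc (members s)) (length-members s))
length-members (false ∷ s) = trans (length-map suc (members s)) (length-members s)

∈-members : (s : Subset n) (j : Fin n) → lookup s j ≡ true → j ∈ members s
∈-members (true  ∷ s) zero    _  = here refl
∈-members (true  ∷ s) (suc j) eq = there (∈-map⁺ suc (∈-members s j eq))
∈-members (false ∷ s) (suc j) eq = ∈-map⁺ suc (∈-members s j eq)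

-- Changing one term shifts the sum by the difference of the two terms; the additive form avoids
-- truncated subtraction.
sum-replace : (i : Fin n) (c c′ : Vector ℕ n) → (∀ j → j ≢ i → c′ j ≡ c j) → sum c′ + c i ≡ sum c + c′ i
sum-replace zero c c′ eq = begin
  (c′ zero + sum (c′ ∘ suc)) + c zero  ≡⟨ cong (λ x → (c′ zero + x) + c zero) (sum-cong-≗ λ j → eq (suc j) λ ()) ⟩
  (c′ zero + sum (c ∘ suc)) + c zero   ≡⟨ swap (c′ zero) (sum (c ∘ suc)) (c zero) ⟩
  (c zero + sum (c ∘ suc)) + c′ zero   ∎
  where
  open ≡-Reasoning
  swap : ∀ x y z → (x + y) + z ≡ (z + y) + x
  swap = solve-∀
sum-replace (suc i) c c′ eq = begin
  (c′ zero + sum (c′ ∘ suc)) + c (suc i)  ≡⟨ +-assoc (c′ zero) _ _ ⟩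
  c′ zero + (sum (c′ ∘ suc) + c (suc i))  ≡⟨ cong₂ _+_ (eq zero λ ()) (sum-replace i (c ∘ suc) (c′ ∘ suc) λ j j≢i → eq (suc j) λ { refl → j≢i refl }) ⟩
  c zero + (sum (c ∘ suc) + c′ (suc i))   ≡⟨ +-assoc (c zero) _ _ ⟨
  (c zero + sum (c ∘ suc)) + c′ (suc i)   ∎
  where open ≡-Reasoning

n<2^n : ∀ n → n < 2 ^ n
n<2^n zero    = s≤s z≤n
n<2^n (suc n) = begin-strict
  suc n          ≡⟨ +-comm 1 n ⟩
  n + 1          <⟨ +-mono-<-≤ (n<2^n n) (m^n>0 2 n) ⟩
  2 ^ n + 2 ^ n  ≡⟨ cong (2 ^ n +_) (+-identityʳ (2 ^ n)) ⟨
  2 ^ suc n      ∎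
  where open ≤-Reasoning

-- Subcubes avoiding a small set

withHead : Bool → List (Vec Bool (suc n)) → List (Vec Bool n)
withHead c     []                  = []
withHead false ((false ∷ b) ∷ bs) = b ∷ withHead false bs
withHead false ((true  ∷ b) ∷ bs) = withHead false bs
withHead true  ((false ∷ b) ∷ bs) = withHead true bs
withHead true  ((true  ∷ b) ∷ bs) = b ∷ withHead true bs

length-withHead : (bs : List (Vec Bool (suc n))) → length (withHead false bs) + length (withHead true bs) ≡ length bs
length-withHead []                  = refl
length-withHead ((false ∷ b) ∷ bs) = cong suc (length-withHead bs)
length-withHead ((true  ∷ b) ∷ bs) = trans (+-suc _ _) (cong suc (length-withHead bs))

∈-withHead : ∀ c {b : Vec Bool n} {bs} → (c ∷ b) ∈ bs → b ∈ withHead c bs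
∈-withHead false (here refl) = here refl
∈-withHead true  (here refl) = here refl
∈-withHead false {bs = (false ∷ _) ∷ _} (there b∈) = there (∈-withHead false b∈)
∈-withHead false {bs = (true  ∷ _) ∷ _} (there b∈) = ∈-withHead false b∈
∈-withHead true  {bs = (false ∷ _) ∷ _} (there b∈) = ∈-withHead true b∈
∈-withHead true  {bs = (true  ∷ _) ∷ _} (there b∈) = there (∈-withHead true b∈)

AgreeOff : Subset n → Vec Bool n → Vec Bool n → Set
AgreeOff D b u = ∀ j → lookup D j ≡ false → lookup b j ≡ lookup u j

-- Induction on coordinates. One in `D` may take either value, so it is projected away without
-- lengthening the list. One off `D` splits the list into two slices, and one of them is shorter
-- than half the bound; the coordinate is set to select that slice.
avoidingSubcube : (D : Subset n) (bs : List (Vec Bool n)) → length bs < 2 ^ ∣ ∁ D ∣ →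
                  ∃ λ u → ∀ b → AgreeOff D b u → b ∉ bs
avoidingSubcube []          []       _         = [] , λ _ _ ()
avoidingSubcube []          (_ ∷ _)  (s≤s ())
avoidingSubcube (true ∷ D) bs lt
  with u , avoids ← avoidingSubcube D (List.map Vec.tail bs) (subst (_< 2 ^ ∣ ∁ D ∣) (sym (length-map Vec.tail bs)) lt)
  -- The entry `false` is arbitrary: agreement is only demanded off `D`.
  = false ∷ u , λ where
    (x ∷ b) agree b∈bs → avoids b (agree ∘ suc) (∈-map⁺ Vec.tail b∈bs)
avoidingSubcube (false ∷ D) bs lt = go (length (withHead false bs) <? 2 ^ ∣ ∁ D ∣)
  where
  extend : ∀ c → length (withHead c bs) < 2 ^ ∣ ∁ D ∣ → ∃ λ u → ∀ b → AgreeOff (false ∷ D) b u → b ∉ bs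
  extend c lt′ with u , avoids ← avoidingSubcube D (withHead c bs) lt′ = c ∷ u , λ where
    (x ∷ b) agree b∈bs → case agree zero refl of λ where
      refl → avoids b (agree ∘ suc) (∈-withHead c b∈bs)

  go : Dec (length (withHead false bs) < 2 ^ ∣ ∁ D ∣) → _
  go (yes lt′) = extend false lt′
  go (no ≮)    = extend true (+-cancelˡ-< (2 ^ ∣ ∁ D ∣) _ _ (begin-strict
    2 ^ ∣ ∁ D ∣ + length (withHead true bs)                 ≤⟨ +-monoˡ-≤ _ (≮⇒≥ ≮) ⟩
    length (withHead false bs) + length (withHead true bs)  ≡⟨ length-withHead bs ⟩
    length bs                                               <⟨ lt ⟩
    2 ^ suc ∣ ∁ D ∣                                         ≡⟨ cong (2 ^ ∣ ∁ D ∣ +_) (+-identityʳ _) ⟩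
    2 ^ ∣ ∁ D ∣ + 2 ^ ∣ ∁ D ∣                               ∎))
    where open ≤-Reasoning

-- The gadget on encoded inputs

decode : Vec Bool ℓ → Fin (2 ^ ℓ)
decode b = funToFin (Inverse.from 2↔Bool ∘ lookup b)

-- Every bit string is the code of a pointer because the range has exactly `2 ^ ℓ` elements. The
-- simulation may thus work on the full bit cube.
binary-decode : (b : Vec Bool ℓ) → binary (decode b) ≡ b
binary-decode b = lookup-ext λ j → trans (lookup∘tabulate _ j)
  (trans (cong (Inverse.to 2↔Bool) (finToFun-funToFin (Inverse.from 2↔Bool ∘ lookup b) j))
    (Inverse.strictlyInverseˡ 2↔Bool (lookup b j)))

gadget : Vec Bool (N * ℓ) → Vec Bool (N * 2 ^ ℓ) → Fin N → Bool
gadget x y i = lookup y (combine i (decode (block i x)))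

gadgets : Vec Bool (N * ℓ) → Vec Bool (N * 2 ^ ℓ) → Vec Bool N
gadgets {ℓ = ℓ} x y = tabulate (gadget {ℓ = ℓ} x y)

decodeAlice : Vec Bool (N * ℓ) → AliceInput ℓ N
decodeAlice x = tabulate (λ i → decode (block i x))

decodeBob : Vec Bool (N * 2 ^ ℓ) → BobInput ℓ N
decodeBob y = tabulate (λ i → block i y)

module _ {ℓ N : ℕ} where

  aliceBits-decodeAlice : (x : Vec Bool (N * ℓ)) → aliceBits {ℓ} (decodeAlice {N} x) ≡ x
  aliceBits-decodeAlice x = block-ext λ i j → begin
    lookup (concat bits) (combine i j)           ≡⟨ lookup-concat bits i j ⟩
    lookup (lookup bits i) j                     ≡⟨ cong (λ b → lookup b j) (lookup-map i (binary {ℓ}) (decodeAlice x)) ⟩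
    lookup (binary {ℓ} (lookup (decodeAlice x) i)) j ≡⟨ cong (λ c → lookup (binary {ℓ} c) j) (lookup∘tabulate _ i) ⟩
    lookup (binary {ℓ} (decode (block i x))) j   ≡⟨ cong (λ b → lookup b j) (binary-decode (block i x)) ⟩
    lookup (block i x) j                         ≡⟨ lookup∘tabulate _ j ⟩
    lookup x (combine i j)                       ∎
    where
    open ≡-Reasoning
    bits = Vec.map (binary {ℓ}) (decodeAlice {N} x)

  bobBits-decodeBob : (y : Vec Bool (N * 2 ^ ℓ)) → bobBits {ℓ} (decodeBob {N} {ℓ} y) ≡ y
  bobBits-decodeBob y = block-ext λ i j →
    trans (lookup-concat (decodeBob {N} {ℓ} y) i j)
      (trans (cong (λ b → lookup b j) (lookup∘tabulate _ i)) (lookup∘tabulate _ j))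

  IND^-decode : (x : Vec Bool (N * ℓ)) (y : Vec Bool (N * 2 ^ ℓ)) →
                IND^ (decodeAlice x) (decodeBob {N} {ℓ} y) ≡ gadgets {ℓ = ℓ} x y
  IND^-decode x y = lookup-ext λ i → begin
    lookup (IND^ x′ y′) i                    ≡⟨ lookup-zipWith IND i x′ y′ ⟩
    lookup (lookup y′ i) (lookup x′ i)       ≡⟨ cong₂ lookup (lookup∘tabulate _ i) (lookup∘tabulate _ i) ⟩
    lookup (block i y) (decode (block i x))  ≡⟨ lookup∘tabulate _ (decode (block i x)) ⟩
    gadget {ℓ = ℓ} x y i                     ≡⟨ lookup∘tabulate _ i ⟨
    lookup (gadgets {ℓ = ℓ} x y) i           ∎
    where
    open ≡-Reasoning
    x′ = decodeAlice {N} x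
    y′ = decodeBob {N} {ℓ} y

-- Simulation of a protocol by a decision tree

Answers : ℕ → Set
Answers N = Vector (Maybe Bool) N

answer : Answers N → Fin N → Bool → Answers N
answer q i β = updateAt q i (const (just β))

Consistent : Answers N → Vec Bool N → Set
Consistent q z = ∀ i {β} → q i ≡ just β → lookup z i ≡ β

consistent-answer : ∀ {q : Answers N} z i → Consistent q z → Consistent (answer q i (lookup z i)) z
consistent-answer {q = q} z i con i′ eq with i′ ≟ i
... | yes refl with refl ← trans (sym eq) (updateAt-updates i q) = refl
... | no i′≢i = con i′ (trans (sym (updateAt-minimal i′ i q i′≢i)) eq)

-- An answered block drops out of the sums below, so answering it releases everything counted there.
weight : Maybe Bool → ℕ → ℕ
weight nothing  c = c
weight (just _) c = 0

weight≤ : ∀ o c → weight o (suc c) ≤ suc (weight o c)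
weight≤ nothing  c = ≤-refl
weight≤ (just _) c = z≤n

-- The termination measure for queries, which leave the protocol node unchanged.
unanswered : Answers N → ℕ
unanswered q = sum λ i → weight (q i) 1

-- The new count `c′ i` has weight zero and may be anything; after `fixBlock` it is the full size of
-- both blocks.
weighted-answer : (q : Answers N) (i : Fin N) (β : Bool) (c c′ : Vector ℕ N) → q i ≡ nothing →
                  (∀ i′ → i′ ≢ i → c′ i′ ≡ c i′) →
                  sum (λ i′ → weight (answer q i β i′) (c′ i′)) + c i ≡ sum (λ i′ → weight (q i′) (c i′))
weighted-answer q i β c c′ qi eq = begin
  sum new + c i    ≡⟨ cong (sum new +_) (cong (λ o → weight o (c i)) qi) ⟨
  sum new + old i  ≡⟨ sum-replace i old new (λ i′ i′≢i → cong₂ weight (updateAt-minimal i′ i q i′≢i) (eq i′ i′≢i)) ⟩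
  sum old + new i  ≡⟨ cong (sum old +_) (cong (λ o → weight o (c′ i)) (updateAt-updates i q)) ⟩
  sum old + 0      ≡⟨ +-identityʳ (sum old) ⟩
  sum old          ∎
  where
  open ≡-Reasoning
  old = λ i′ → weight (q i′) (c i′)
  new = λ i′ → weight (answer q i β i′) (c′ i′)

unanswered-answer : (q : Answers N) (i : Fin N) (β : Bool) → q i ≡ nothing → unanswered (answer q i β) < unanswered q
unanswered-answer q i β qi = ≤-reflexive (trans (+-comm 1 _) (weighted-answer q i β (const 1) (const 1) qi λ _ _ → refl))

weighted-suc : (q : Answers N) (i : Fin N) (c c′ : Vector ℕ N) → c′ i ≡ suc (c i) → (∀ i′ → i′ ≢ i → c′ i′ ≡ c i′) →
               sum (λ i′ → weight (q i′) (c′ i′)) ≤ suc (sum (λ i′ → weight (q i′) (c i′)))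
weighted-suc q i c c′ ci eq = +-cancelʳ-≤ (old i) _ _ (begin
  sum new + old i        ≡⟨ sum-replace i old new (λ i′ i′≢i → cong (weight (q i′)) (eq i′ i′≢i)) ⟩
  sum old + new i        ≡⟨ cong (λ x → sum old + weight (q i) x) ci ⟩
  sum old + weight (q i) (suc (c i)) ≤⟨ +-monoʳ-≤ (sum old) (weight≤ (q i) (c i)) ⟩
  sum old + suc (old i)  ≡⟨ +-suc (sum old) (old i) ⟩
  suc (sum old) + old i  ∎)
  where
  open ≤-Reasoning
  old = λ i′ → weight (q i′) (c i′)
  new = λ i′ → weight (q i′) (c′ i′)

-- Potential, invariant and steering of a block

module _ {ℓ N : ℕ} where

  Alice : Set
  Alice = Parametrization N ℓ

  Bob : Set
  Bob = Parametrization N (2 ^ ℓ)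

  boundCount : Alice → Bob → Vector ℕ N
  boundCount A B i = ∣ bound A i ∣ + ∣ bound B i ∣

  -- The credit in hand: halvings of the leaf count already made whose bound variables have not yet
  -- been used to pay for a query.
  potential : Answers N → Alice → Bob → ℕ
  potential q A B = sum λ i → weight (q i) (boundCount A B i)

  -- Room guarantees that some assignment of Alice's free variables in block i keeps
  -- her pointer away from Bob's bound variables, however her bound ones behave.
  Room : Alice → Bob → Fin N → Set
  Room A B i = ∣ bound B i ∣ < 2 ^ ∣ ∁ (bound A i) ∣

  -- In an answered block the gadget is constant over all remaining input pairs, so later
  -- restrictions cannot disturb it.
  record Invariant (q : Answers N) (A : Alice) (B : Bob) : Set where
    field
      open-block   : ∀ i → q i ≡ nothing → Room A B i
      closed-block : ∀ i {β} → q i ≡ just β → ∀ v w → gadget {ℓ = ℓ} (point A v) (point B w) i ≡ β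

  open Invariant

  -- Only the parameters of block `i` are prescribed. Bound coordinates there may depend on the
  -- other blocks, so the conclusion has to hold for all values of those, which allows blocks to be
  -- steered independently.
  Steers : Alice → Bob → Fin N → Vec Bool ℓ → Set
  Steers A B i u = ∀ v w β → (∀ j → lookup v (combine i j) ≡ lookup u j) → (∀ j → lookup w (combine i j) ≡ β) →
                   gadget {ℓ = ℓ} (point A v) (point B w) i ≡ β

  -- The forbidden strings are the addresses of Bob's bound variables. On a subcube avoiding them
  -- the pointer selects a free variable of Bob, whose value is the parameter `β`.
  steer : (A : Alice) (B : Bob) (i : Fin N) → Room A B i → ∃ (Steers A B i)
  steer A B i room
    with u , avoids ← avoidingSubcube (bound A i) (List.map (binary {ℓ}) (members (bound B i)))
           (subst (_< 2 ^ ∣ ∁ (bound A i) ∣) (sym (trans (length-map (binary {ℓ}) (members (bound B i))) (length-members (bound B i)))) room)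
    = u , λ v w β v≡u w≡β →
      let
        b = block i (point A v)
        agree : AgreeOff (bound A i) b u
        agree j free = trans (lookup∘tabulate _ j) (trans (free-point A i j free v) (v≡u j))
        pointer-free : lookup (bound B i) (decode b) ≡ false
        pointer-free = ¬-not λ eq → avoids b agree
          (subst (_∈ List.map (binary {ℓ}) (members (bound B i))) (binary-decode b)
            (∈-map⁺ (binary {ℓ}) (∈-members (bound B i) (decode b) eq)))
      in trans (free-point B i (decode b) pointer-free w) (w≡β (decode b))

  -- Used at the leaves: since every consistent `z` still occurs as a gadget value, a single output
  -- must be correct for all of them.
  realize : ∀ {q A B} → Invariant q A B → ∀ z → Consistent q z → ∃₂ λ v w → gadgets {ℓ = ℓ} (point A v) (point B w) ≡ z
  realize {q} {A} {B} inv z con = v , w , lookup-ext λ i → trans (lookup∘tabulate _ i) (agree i)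
    where
    -- In an answered block the gadget is already fixed, so `𝟎` serves as a default.
    choice : ∀ i → ∃ λ u → q i ≡ nothing → Steers A B i u
    choice i with q i in eq
    ... | just _  = 𝟎 , λ ()
    ... | nothing with u , steers ← steer A B i (open-block inv i eq) = u , λ _ → steers

    v = blockwise λ i j → lookup (proj₁ (choice i)) j
    -- Bob fills the whole block with one value, so it does not matter which free address the
    -- pointer hits.
    w = blockwise {k = 2 ^ ℓ} λ i _ → lookup z i

    agree : ∀ i → gadget {ℓ = ℓ} (point A v) (point B w) i ≡ lookup z i
    agree i with q i in eq
    ... | just β  = trans (closed-block inv i eq v w) (sym (con i eq))
    ... | nothing = proj₂ (choice i) eq v w (lookup z i) (lookup-blockwise _ i) (lookup-blockwise _ i)

  closeBlock-invariant : ∀ {q A B} i u → Steers A B i u → Invariant q A B → ∀ β →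
                         Invariant (answer q i β) (fixBlock i u A) (fixBlock i (replicate _ β) B)
  closeBlock-invariant {q} {A} {B} i u steers inv β = record { open-block = open′ ; closed-block = closed′ }
    where
    open′ : ∀ i′ → answer q i β i′ ≡ nothing → Room (fixBlock i u A) (fixBlock i (replicate _ β) B) i′
    open′ i′ eq with i′ ≟ i
    ... | yes refl with () ← trans (sym eq) (updateAt-updates i q)
    ... | no i′≢i = subst₂ (λ s t → ∣ t ∣ < 2 ^ ∣ ∁ s ∣)
      (sym (updateAt-minimal i′ i (bound A) i′≢i)) (sym (updateAt-minimal i′ i (bound B) i′≢i))
      (open-block inv i′ (trans (sym (updateAt-minimal i′ i q i′≢i)) eq))

    closed′ : ∀ i′ {γ} → answer q i β i′ ≡ just γ → ∀ v w →
              gadget {ℓ = ℓ} (point (fixBlock i u A) v) (point (fixBlock i (replicate _ β) B) w) i′ ≡ γ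
    closed′ i′ eq v w with i′ ≟ i
    ... | yes refl with refl ← trans (sym eq) (updateAt-updates i q) =
      steers _ _ β (lookup-overwrite i u v) λ j → trans (lookup-overwrite i (replicate _ β) w j) (lookup-replicate j β)
    ... | no i′≢i = closed-block inv i′ (trans (sym (updateAt-minimal i′ i q i′≢i)) eq) _ _

  closeBlock-potential : ∀ q (A : Alice) (B : Bob) i u β → q i ≡ nothing → ℓ ≤ boundCount A B i →
                         potential (answer q i β) (fixBlock i u A) (fixBlock i (replicate _ β) B) + ℓ ≤ potential q A B
  closeBlock-potential q A B i u β qi ℓ≤ = ≤-trans (+-monoʳ-≤ _ ℓ≤) (≤-reflexive
    (weighted-answer q i β (boundCount A B) _ qi λ i′ i′≢i →
      cong₂ (λ s t → ∣ s ∣ + ∣ t ∣) (updateAt-minimal i′ i (bound A) i′≢i) (updateAt-minimal i′ i (bound B) i′≢i)))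

  full : ∀ (A : Alice) (B : Bob) i → ∣ ∁ (bound A i) ∣ ≤ ∣ bound B i ∣ → ℓ ≤ boundCount A B i
  full A B i le = ≤-trans (≤-reflexive (sym (∣p∣+∣∁p∣≡n (bound A i)))) (+-monoʳ-≤ ∣ bound A i ∣ le)

  -- Binding one more variable of Alice or of Bob

  module _ {q : Answers N} {A : Alice} {B : Bob} (inv : Invariant q A B) where

    module _ (S : Subset (N * ℓ)) (i : Fin N) (j : Fin ℓ) (pivot : parity S (slope A i j) ≡ true) (b : Bool) where

      private
        A′   = restricted A S i j pivot b
        free = pivot-free A S i j pivot b

        bound-i : bound A′ i ≡ bound A i [ j ]≔ true
        bound-i = updateAt-updates i (bound A)

        bound-other : ∀ i′ → i′ ≢ i → bound A′ i′ ≡ bound A i′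
        bound-other i′ = updateAt-minimal i′ i (bound A)

      restrictAlice-potential : potential q A′ B ≤ suc (potential q A B)
      restrictAlice-potential = weighted-suc q i (boundCount A B) (boundCount A′ B)
        (cong (_+ ∣ bound B i ∣) (trans (cong ∣_∣ bound-i) (∣insert∣ (bound A i) j free)))
        (λ i′ i′≢i → cong (λ s → ∣ s ∣ + ∣ bound B i′ ∣) (bound-other i′ i′≢i))

      restrictAlice-invariant : (q i ≡ nothing → Room A′ B i) → Invariant q A′ B
      restrictAlice-invariant room .open-block i′ eq with i′ ≟ i
      ... | yes refl = room eq
      ... | no i′≢i  = subst (λ s → ∣ bound B i′ ∣ < 2 ^ ∣ ∁ s ∣) (sym (bound-other i′ i′≢i)) (open-block inv i′ eq)
      -- Points of `A′` are points of `A`, so constancy is inherited.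
      restrictAlice-invariant room .closed-block i′ eq v w = closed-block inv i′ eq _ w

      -- The second alternative speaks of the state before the restriction: the block is already
      -- full enough to be queried before the bit is answered.
      restrictAlice : Invariant q A′ B ⊎ (q i ≡ nothing × ℓ ≤ boundCount A B i)
      restrictAlice with q i in eq
      ... | just _ = inj₁ (restrictAlice-invariant λ eq′ → case trans (sym eq) eq′ of λ ())
      ... | nothing with ∣ bound B i ∣ <? 2 ^ ∣ ∁ (bound A′ i) ∣
      ...   | yes room = inj₁ (restrictAlice-invariant (const room))
      ...   | no ≮     = inj₂ (refl , full A B i (begin
        ∣ ∁ (bound A i) ∣                   ≡⟨ ∣∁insert∣ (bound A i) j free ⟩
        suc ∣ ∁ (bound A i [ j ]≔ true) ∣   ≡⟨ cong (λ s → suc ∣ ∁ s ∣) bound-i ⟨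
        -- `n<2^n` turns the failed exponential inequality into a linear one; its strictness covers
        -- the variable about to be bound.
        suc ∣ ∁ (bound A′ i) ∣              ≤⟨ n<2^n _ ⟩
        2 ^ ∣ ∁ (bound A′ i) ∣              ≤⟨ ≮⇒≥ ≮ ⟩
        ∣ bound B i ∣                       ∎))
        where open ≤-Reasoning

    module _ (S : Subset (N * 2 ^ ℓ)) (i : Fin N) (j : Fin (2 ^ ℓ)) (pivot : parity S (slope B i j) ≡ true) (b : Bool) where

      private
        B′   = restricted B S i j pivot b
        free = pivot-free B S i j pivot b

        ∣bound-i∣ : ∣ bound B′ i ∣ ≡ suc ∣ bound B i ∣
        ∣bound-i∣ = trans (cong ∣_∣ (updateAt-updates i (bound B))) (∣insert∣ (bound B i) j free)

        bound-other : ∀ i′ → i′ ≢ i → bound B′ i′ ≡ bound B i′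
        bound-other i′ = updateAt-minimal i′ i (bound B)

      restrictBob-potential : potential q A B′ ≤ suc (potential q A B)
      restrictBob-potential = weighted-suc q i (boundCount A B) (boundCount A B′)
        (trans (cong (∣ bound A i ∣ +_) ∣bound-i∣) (+-suc _ _))
        (λ i′ i′≢i → cong (λ s → ∣ bound A i′ ∣ + ∣ s ∣) (bound-other i′ i′≢i))

      restrictBob-invariant : (q i ≡ nothing → Room A B′ i) → Invariant q A B′
      restrictBob-invariant room .open-block i′ eq with i′ ≟ i
      ... | yes refl = room eq
      ... | no i′≢i  = subst (λ s → ∣ s ∣ < 2 ^ ∣ ∁ (bound A i′) ∣) (sym (bound-other i′ i′≢i)) (open-block inv i′ eq)
      restrictBob-invariant room .closed-block i′ eq v w = closed-block inv i′ eq v _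

      restrictBob : Invariant q A B′ ⊎ (q i ≡ nothing × ℓ ≤ boundCount A B i)
      restrictBob with q i in eq
      ... | just _ = inj₁ (restrictBob-invariant λ eq′ → case trans (sym eq) eq′ of λ ())
      ... | nothing with ∣ bound B′ i ∣ <? 2 ^ ∣ ∁ (bound A i) ∣
      ...   | yes room = inj₁ (restrictBob-invariant (const room))
      ...   | no ≮     = inj₂ (refl , full A B i (≤-pred (begin
        -- Here the new variable is Bob's, and the same strictness cancels the successor on his
        -- side.
        suc ∣ ∁ (bound A i) ∣  ≤⟨ n<2^n _ ⟩
        2 ^ ∣ ∁ (bound A i) ∣  ≤⟨ ≮⇒≥ ≮ ⟩
        ∣ bound B′ i ∣         ≡⟨ ∣bound-i∣ ⟩
        suc ∣ bound B i ∣      ∎)))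
        where open ≤-Reasoning

  -- Construction of the decision tree

  module _ {W : Set a} (R : REL (Vec Bool N) W r) where

    Protocol : Set _
    Protocol = ParityProtocol (N * ℓ) (N * 2 ^ ℓ) (Maybe W)

    Solves : Protocol → Alice → Bob → Set _
    Solves Π A B = ∀ v w → Correct R (gadgets {ℓ = ℓ} (point A v) (point B w)) (run Π (point A v) (point B w))

    -- In logarithms, `bounded` says that `ℓ` times the height is at most the logarithm of the leaf
    -- count plus the stored credit.
    record Simulation (q : Answers N) (L Φ : ℕ) : Set (a Level.⊔ r) where
      constructor simulation
      field
        tree    : DecisionTree N (Maybe W)
        correct : ∀ z → Consistent q z → Correct R z (evaluate tree z)
        bounded : 2 ^ (ℓ * height tree) ≤ L * 2 ^ Φ

    -- One more level costs a factor `2 ^ ℓ`, paid by the drop of `ℓ` in the potential; `L` stays,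
    -- as the protocol does not advance.
    queryBlock : ∀ q {L Φ} i → (∀ β → ∃ λ Φ′ → Φ′ + ℓ ≤ Φ × Simulation (answer q i β) L Φ′) → Simulation q L Φ
    queryBlock q {L} {Φ} i sims
      with Φ₀ , drop₀ , simulation T₀ correct₀ le₀ ← sims false | Φ₁ , drop₁ , simulation T₁ correct₁ le₁ ← sims true
      = simulation (query i T₀ T₁) correct bounded
      where
      correct : ∀ z → Consistent q z → Correct R z (evaluate (query i T₀ T₁) z)
      correct z con with lookup z i in eq
      ... | false = correct₀ z (subst (λ β → Consistent (answer q i β) z) eq (consistent-answer z i con))
      ... | true  = correct₁ z (subst (λ β → Consistent (answer q i β) z) eq (consistent-answer z i con))

      branch : ∀ h {Φ′} → Φ′ + ℓ ≤ Φ → 2 ^ (ℓ * h) ≤ L * 2 ^ Φ′ → 2 ^ (ℓ * suc h) ≤ L * 2 ^ Φ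
      branch h {Φ′} drop le = begin
        2 ^ (ℓ * suc h)         ≡⟨ cong (2 ^_) (trans (*-suc ℓ h) (+-comm ℓ _)) ⟩
        2 ^ (ℓ * h + ℓ)         ≡⟨ ^-distribˡ-+-* 2 (ℓ * h) ℓ ⟩
        2 ^ (ℓ * h) * 2 ^ ℓ     ≤⟨ *-monoˡ-≤ (2 ^ ℓ) le ⟩
        L * 2 ^ Φ′ * 2 ^ ℓ      ≡⟨ *-assoc L _ _ ⟩
        L * (2 ^ Φ′ * 2 ^ ℓ)    ≡⟨ cong (L *_) (^-distribˡ-+-* 2 Φ′ ℓ) ⟨
        L * 2 ^ (Φ′ + ℓ)        ≤⟨ *-monoʳ-≤ L (^-monoʳ-≤ 2 drop) ⟩
        L * 2 ^ Φ               ∎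
        where open ≤-Reasoning

      bounded : 2 ^ (ℓ * suc (height T₀ ⊔ height T₁)) ≤ L * 2 ^ Φ
      bounded with ⊔-sel (height T₀) (height T₁)
      ... | inj₁ eq = subst (λ h → 2 ^ (ℓ * suc h) ≤ L * 2 ^ Φ) (sym eq) (branch (height T₀) drop₀ le₀)
      ... | inj₂ eq = subst (λ h → 2 ^ (ℓ * suc h) ≤ L * 2 ^ Φ) (sym eq) (branch (height T₁) drop₁ le₁)

    enlarge : ∀ {q l L Φ} → l ≤ L → Simulation q l Φ → Simulation q L Φ
    enlarge {Φ = Φ} l≤L (simulation T correct bounded) =
      simulation T correct (≤-trans bounded (*-monoˡ-≤ (2 ^ Φ) l≤L))

    child : Bool → Protocol → Protocol → Protocol
    child b s t = if b then t else s

    child-leaves : ∀ b s t → leaves (child b s t) ≤ leaves s + leaves t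
    child-leaves false s t = m≤m+n _ _
    child-leaves true  s t = m≤n+m _ _

    smallerChild : ∀ s t → ∃ λ b → 2 * leaves (child b s t) ≤ leaves s + leaves t
    smallerChild s t with ≤-total (leaves s) (leaves t)
    ... | inj₁ s≤t = false , +-monoʳ-≤ (leaves s) (≤-trans (≤-reflexive (+-identityʳ _)) s≤t)
    ... | inj₂ t≤s = true  , +-mono-≤ t≤s (≤-reflexive (+-identityʳ _))

    -- Halving the leaf count pays for one new unit of potential.
    double : ∀ {q l L Φ Φ′} → 2 * l ≤ L → Φ′ ≤ suc Φ → Simulation q l Φ′ → Simulation q L Φ
    double {l = l} {L} {Φ} {Φ′} 2l≤L Φ′≤ (simulation T correct bounded) = simulation T correct (begin
      2 ^ (ℓ * height T)  ≤⟨ bounded ⟩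
      l * 2 ^ Φ′          ≤⟨ *-monoʳ-≤ l (^-monoʳ-≤ 2 Φ′≤) ⟩
      l * (2 * 2 ^ Φ)     ≡⟨ *-assoc l 2 _ ⟨
      l * 2 * 2 ^ Φ       ≡⟨ cong (_* 2 ^ Φ) (*-comm l 2) ⟩
      2 * l * 2 ^ Φ       ≤⟨ *-monoˡ-≤ (2 ^ Φ) 2l≤L ⟩
      L * 2 ^ Φ           ∎)
      where open ≤-Reasoning

    run-alice : ∀ S s t {x y b} → parity S x ≡ b → run (alice S s t) x y ≡ run (child b s t) x y
    run-alice S s t {b = false} eq rewrite eq = refl
    run-alice S s t {b = true}  eq rewrite eq = refl

    run-bob : ∀ S s t {x y b} → parity S y ≡ b → run (bob S s t) x y ≡ run (child b s t) x y
    run-bob S s t {b = false} eq rewrite eq = refl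
    run-bob S s t {b = true}  eq rewrite eq = refl

    -- The recursion is lexicographic: `closeBlock` keeps `Π` but lowers `unanswered q`, and every
    -- other call passes to a subtree.
    simulate : ∀ Π q A B → Acc _<_ (unanswered q) → Invariant q A B → Solves Π A B →
               Simulation q (leaves Π) (potential q A B)

    closeBlock : ∀ Π q A B → Acc _<_ (unanswered q) → Invariant q A B → Solves Π A B →
                 ∀ i → q i ≡ nothing × ℓ ≤ boundCount A B i → Simulation q (leaves Π) (potential q A B)

    -- Splitting on `b` here makes the recursive calls visibly structural in `s` or `t`.
    simulateChild : ∀ b s t q A B → Acc _<_ (unanswered q) → Invariant q A B → Solves (child b s t) A B →
                    Simulation q (leaves (child b s t)) (potential q A B)

    simulate (leaf o) q A B _ inv solves = simulation (leaf o) correct bounded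
      where
      correct : ∀ z → Consistent q z → Correct R z o
      correct z con with v , w , eq ← realize inv z con = subst (λ z → Correct R z o) eq (solves v w)

      bounded : 2 ^ (ℓ * 0) ≤ 1 * 2 ^ potential q A B
      bounded = subst₂ _≤_ (cong (2 ^_) (sym (*-zeroʳ ℓ))) (sym (*-identityˡ _)) (m^n>0 2 (potential q A B))
    simulate Π@(alice S s t) q A B ac inv solves with constant⊎pivot A S
    ... | inj₁ (b , constant) = enlarge (child-leaves b s t)
      (simulateChild b s t q A B ac inv λ v w → subst (Correct R _) (run-alice S s t (constant v)) (solves v w))
    -- A parity with a pivot takes both values, so the answer may be chosen freely, without a query.
    ... | inj₂ (i , j , pivot) with b , half ← smallerChild s t with restrictAlice inv S i j pivot b
    ...   | inj₁ inv′ = double half (restrictAlice-potential inv S i j pivot b)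
      (simulateChild b s t q (restricted A S i j pivot b) B ac inv′ λ v w →
        subst (Correct R _) (run-alice S s t (parity-adjust A S i j pivot b v)) (solves _ w))
    ...   | inj₂ full-block = closeBlock Π q A B ac inv solves i full-block
    simulate Π@(bob S s t) q A B ac inv solves with constant⊎pivot B S
    ... | inj₁ (b , constant) = enlarge (child-leaves b s t)
      (simulateChild b s t q A B ac inv λ v w → subst (Correct R _) (run-bob S s t (constant w)) (solves v w))
    ... | inj₂ (i , j , pivot) with b , half ← smallerChild s t with restrictBob inv S i j pivot b
    ...   | inj₁ inv′ = double half (restrictBob-potential inv S i j pivot b)
      (simulateChild b s t q A (restricted B S i j pivot b) ac inv′ λ v w →
        subst (Correct R _) (run-bob S s t (parity-adjust B S i j pivot b w)) (solves v _))
    ...   | inj₂ full-block = closeBlock Π q A B ac inv solves i full-block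

    -- The same `u` serves both answers, and the same node `Π` is simulated again on the restricted
    -- inputs.
    closeBlock Π q A B (acc rs) inv solves i (qi , ℓ≤) with u , steers ← steer A B i (open-block inv i qi) =
      queryBlock q i λ β → _ , closeBlock-potential q A B i u β qi ℓ≤ ,
        simulate Π (answer q i β) (fixBlock i u A) (fixBlock i (replicate _ β) B) (rs (unanswered-answer q i β qi))
          (closeBlock-invariant i u steers inv β) (λ v w → solves _ _)

    simulateChild false s t = simulate s
    simulateChild true  s t = simulate t

    -- Initially nothing is bound, so the potential is zero and the bound involves only the leaves.
    decisionTree : (Π : Protocol) → SolvedByProtocol {ℓ = ℓ} (R ∘IND[ 2 ^ ℓ ]) Π →
                   Σ (DecisionTree N (Maybe W)) λ T → SolvedByTree R T × 2 ^ (ℓ * height T) ≤ leaves Π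
    decisionTree Π solved =
      let simulation T correct bounded = simulate Π (const nothing) unrestricted unrestricted (<-wellFounded _) invariant solves
      in T , (λ z → correct z λ _ ()) ,
         ≤-trans bounded (≤-reflexive (trans (cong (λ Φ → leaves Π * 2 ^ Φ) potential≡0) (*-identityʳ _)))
      where
      potential≡0 : potential (const nothing) unrestricted unrestricted ≡ 0
      potential≡0 = trans (sum-cong-≗ {N} λ _ → cong₂ _+_ (∣⊥∣≡0 ℓ) (∣⊥∣≡0 (2 ^ ℓ))) (sum-replicate-zero +-0-monoid N)

      invariant : Invariant (const nothing) unrestricted unrestricted
      invariant .open-block i _ = subst (_< 2 ^ ∣ ∁ (⊥ {ℓ}) ∣) (sym (∣⊥∣≡0 (2 ^ ℓ))) (m^n>0 2 ∣ ∁ (⊥ {ℓ}) ∣)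
      invariant .closed-block _ ()

      fromComposed : ∀ {x y o} → Correct (R ∘IND[ 2 ^ ℓ ]) (x , y) o → Correct R (IND^ x y) o
      fromComposed (related Rzw) = related Rzw
      fromComposed (none ∄w)     = none ∄w

      solves : Solves Π unrestricted unrestricted
      solves v w = subst₂ (Correct R) (IND^-decode {ℓ} {N} v w)
        (cong₂ (run Π) (aliceBits-decodeAlice {ℓ} {N} v) (bobBits-decodeBob {ℓ} {N} w))
        (fromComposed (solved (decodeAlice {N} {ℓ} v) (decodeBob {N} {ℓ} w)))

theorem17 : (a r : Level) →
    Σ ℕ λ c →
    (ℓ : ℕ) → 4 ≤ 2 ^ ℓ →
    (N : ℕ) (W : Set a) (R : REL (Vec Bool N) W r) →
    (d L : ℕ) → IsCdt R d → IsL⊕⊕ {ℓ = ℓ} (R ∘IND[ 2 ^ ℓ ]) L →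
    (2 ^ ℓ) ^ d ≤ L ^ c
-- The logarithmic bound is in exponential form; its constant is 1, since each query uses up a full
-- factor `2 ^ ℓ` of the leaves.
theorem17 a r = 1 , λ where
  ℓ _ N W R d L (_ , minimal) ((Π , solved , leaves≡L) , _) →
    let T , correct , bounded = decisionTree {ℓ = ℓ} R Π solved
        open ≤-Reasoning
    in begin
      (2 ^ ℓ) ^ d         ≡⟨ ^-*-assoc 2 ℓ d ⟩
      2 ^ (ℓ * d)         ≤⟨ ^-monoʳ-≤ 2 (*-monoʳ-≤ ℓ (minimal (height T) (T , correct , refl))) ⟩
      2 ^ (ℓ * height T)  ≤⟨ bounded ⟩
      leaves Π            ≡⟨ leaves≡L ⟩
      L                   ≡⟨ *-identityʳ L ⟨
      L ^ 1               ∎
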